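{- Let $n\ge 1$ and $\mathbf{w}\in\mathcal{K}_{m+}\setminus\{\mathbf{0}\}\subset\mathbb{R}^n$, and let $\tau_i=\bigl(\sum_{j=1}^i w_j\bigr)^{ -1}$ for $i=1,\dots,n$. The dual norm of $\Omega_{\mathbf{w}}$ is given, for every $\mathbf{x}\in\mathbb{R}^n$, by $$\Omega_{\mathbf{w}}^*(\mathbf{x})=\max\bigl\{\tau_i\,\|\mathbf{x}_{(i)}\|_1:\ i=1,\dots,n\bigr\}.$$
   Context: $\mathcal{K}_{m+}=\{\mathbf{x}\in\mathbb{R}^n: x_1\ge x_2\ge\cdots\ge x_n\ge 0\}$ is the monotone non-negative cone. The ordered weighted $\ell_1$ (OWL) norm is $\Omega_{\mathbf{w}}(\mathbf{x})=\sum_{i=1}^n w_i\,|x|_{[i]}$, where $|x|_{[1]}\ge\cdots\ge|x|_{[n]}$ are the absolute values of the components of $\mathbf{x}$ sorted in non-increasing order. The dual norm is $\Omega_{\mathbf{w}}^*(\mathbf{x})=\max\{\mathbf{u}^T\mathbf{x}:\ \mathbf{u}\in\mathbb{R}^n,\ \Omega_{\mathbf{w}}(\mathbf{u})\le 1\}$. For $\mathbf{x}\in\mathbb{R}^n$, $\mathbf{x}_{(i)}\in\mathbb{R}^i$ is the sub-vector of $\mathbf{x}$ consisting of its $i$ largest components in magnitude, so that $\|\mathbf{x}_{(i)}\|_1=\sum_{j=1}^i|x|_{[j]}$. -}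

module Defs where

open import Level using (Level; suc; _⊔_)
open import Algebra.Core using (Op₁; Op₂)
open import Algebra.Bundles using (CommutativeRing)
open import Algebra.Structures using (IsCommutativeRing)
open import Data.Fin.Base as Fin using (Fin; toℕ; inject≤)
open import Data.Fin.Properties using (toℕ<n)
open import Data.List.Base using (lookup; length)
open import Data.List.Properties using (length-tabulate)
open import Data.List.Relation.Binary.Permutation.Propositional.Properties
  using (↭-length)
import Data.List.Extrema
import Data.List.Sort
open import Data.Nat.Base as ℕ using (ℕ; NonZero)
open import Data.Product.Base using (∃; _×_)
open import Data.Vec.Functional as Vector using (Vector; head; tail; toList)
open import Function.Base using (_∘_)
open import Relation.Binary.Bundles using (DecTotalOrder)
open import Relation.Binary.Core using (Rel)
open import Relation.Binary.PropositionalEquality.Core using (_≡_; sym; trans)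
open import Relation.Binary.Structures using (IsDecTotalOrder)
import Relation.Binary.Construct.Flip.EqAndOrd as Flip
import Relation.Binary.Construct.On as On
open import Relation.Nullary.Negation.Core using (¬_)
open import Relation.Unary using (Pred)
import Algebra.Construct.NaturalChoice.Max
import Algebra.Properties.CommutativeMonoid.Sum

module _ {a ℓ p : Level} {A : Set a} (_≤_ : Rel A ℓ) where

  IsUpperBound : Pred A p → A → Set (a ⊔ ℓ ⊔ p)
  IsUpperBound P b = ∀ y → P y → y ≤ b

  IsSupremum : Pred A p → A → Set (a ⊔ ℓ ⊔ p)
  IsSupremum P s = IsUpperBound P s × (∀ b → IsUpperBound P b → s ≤ b)

  IsMaximum : Pred A p → A → Set (a ⊔ ℓ ⊔ p)
  IsMaximum P m = P m × IsUpperBound P m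

-- The classical axioms of the real numbers, which determine ℝ up to
-- isomorphism.  The order is decidable, as it is classically.  The inverse is
-- total, with an unspecified value at 0#.

record CompleteOrderedField (c ℓ₁ ℓ₂ : Level) : Set (suc (c ⊔ ℓ₁ ⊔ ℓ₂)) where
  infix  8 _⁻¹
  infix  8 -_
  infixl 7 _*_
  infixl 6 _+_
  infix  4 _≈_ _≤_
  field
    Carrier           : Set c
    _≈_               : Rel Carrier ℓ₁
    _≤_               : Rel Carrier ℓ₂
    _+_ _*_           : Op₂ Carrier
    -_ _⁻¹            : Op₁ Carrier
    0# 1#             : Carrier
    isCommutativeRing : IsCommutativeRing _≈_ _+_ _*_ -_ 0# 1#
    1≉0               : ¬ (1# ≈ 0#)
    ⁻¹-inverseʳ       : ∀ x → ¬ (x ≈ 0#) → x * x ⁻¹ ≈ 1#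
    isDecTotalOrder   : IsDecTotalOrder _≈_ _≤_
    +-monoˡ-≤         : ∀ x {y z} → y ≤ z → y + x ≤ z + x
    *-nonNegative     : ∀ {x y} → 0# ≤ x → 0# ≤ y → 0# ≤ x * y
    complete          : (P : Pred Carrier (c ⊔ ℓ₁ ⊔ ℓ₂)) →
                        ∃ P → ∃ (IsUpperBound _≤_ P) → ∃ (IsSupremum _≤_ P)

  commutativeRing : CommutativeRing c ℓ₁
  commutativeRing = record { isCommutativeRing = isCommutativeRing }

  decTotalOrder : DecTotalOrder c ℓ₁ ℓ₂
  decTotalOrder = record { isDecTotalOrder = isDecTotalOrder }

  open CommutativeRing commutativeRing public
    using (+-commutativeMonoid)
  open DecTotalOrder decTotalOrder public
    using (totalOrder)

module _ {c ℓ₁ ℓ₂ : Level} (O : DecTotalOrder c ℓ₁ ℓ₂) where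
  open DecTotalOrder O using (Carrier)
  open Data.List.Sort O using (sort; sort-↭)

  length-sort : ∀ {n} (v : Vector Carrier n) → n ≡ length (sort (toList v))
  length-sort v =
    sym (trans (↭-length (sort-↭ (toList v))) (length-tabulate v))

  sortVector : ∀ {n} → Vector Carrier n → Vector Carrier n
  sortVector v i = lookup (sort (toList v)) (Fin.cast (length-sort v) i)

module OWL {c ℓ₁ ℓ₂ : Level} (ℝ : CompleteOrderedField c ℓ₁ ℓ₂) where

  open CompleteOrderedField ℝ
  open Algebra.Properties.CommutativeMonoid.Sum +-commutativeMonoid using (sum)
  open Algebra.Construct.NaturalChoice.Max totalOrder
    renaming (_⊔_ to _∨_) using ()
  open Data.List.Extrema totalOrder using (max)

  ℝ^ : ℕ → Set c
  ℝ^ n = Vector Carrier n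

  ∣_∣ : Carrier → Carrier
  ∣ a ∣ = a ∨ (- a)

  ‖_‖₁ : ∀ {n} → ℝ^ n → Carrier
  ‖ x ‖₁ = sum (∣_∣ ∘ x)

  infixl 7 _·_
  _·_ : ∀ {n} → ℝ^ n → ℝ^ n → Carrier
  u · x = sum (λ i → u i * x i)

  maximum : ∀ {n} .{{_ : NonZero n}} → ℝ^ n → Carrier
  maximum {ℕ.suc n} v = max (head v) (toList (tail v))

  -- The index i : Fin n stands for the 1-based index suc (toℕ i).
  leading : ∀ {n} → ℝ^ n → (i : Fin n) → ℝ^ (ℕ.suc (toℕ i))
  leading x i j = x (inject≤ j (toℕ<n i))

  -- The cone 𝒦ₘ₊.
  MonotoneNonNegative : ∀ {n} → ℝ^ n → Set ℓ₂
  MonotoneNonNegative x =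
    (∀ i j → i Fin.≤ j → x j ≤ x i) × (∀ i → 0# ≤ x i)

  IsZero : ∀ {n} → ℝ^ n → Set ℓ₁
  IsZero x = ∀ i → x i ≈ 0#

  ≥-decTotalOrder : DecTotalOrder c ℓ₁ ℓ₂
  ≥-decTotalOrder = Flip.decTotalOrder decTotalOrder

  magnitude-≥-decTotalOrder : DecTotalOrder c ℓ₁ ℓ₂
  magnitude-≥-decTotalOrder = On.decTotalOrder ≥-decTotalOrder ∣_∣

  ∣_∣[_] : ∀ {n} → ℝ^ n → Fin n → Carrier
  ∣ x ∣[ i ] = sortVector ≥-decTotalOrder (∣_∣ ∘ x) i

  -- x ₍ i ₎ keeps the (signed) components of largest magnitude; ties are broken
  -- by the sorting algorithm.
  _₍_₎ : ∀ {n} → ℝ^ n → (i : Fin n) → ℝ^ (ℕ.suc (toℕ i))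
  x ₍ i ₎ = leading (sortVector magnitude-≥-decTotalOrder x) i

  Ω : ∀ {n} → ℝ^ n → ℝ^ n → Carrier
  Ω w x = sum (λ i → w i * ∣ x ∣[ i ])

  -- d is the value at x of the norm dual to N.  The maximum of an infinite set
  -- need not exist, so the dual norm is a relation.
  IsDualNorm : ∀ {n} → (ℝ^ n → Carrier) → ℝ^ n → Carrier → Set (c ⊔ ℓ₁ ⊔ ℓ₂)
  IsDualNorm N x = IsMaximum _≤_ (λ r → ∃ λ u → N u ≤ 1# × r ≈ u · x)

  τ : ∀ {n} → ℝ^ n → Fin n → Carrier
  τ w i = sum (leading w i) ⁻¹

{-# OPTIONS --safe #-}
-- Both halves rest on Abel summation: if a is non-negative and non-increasing
-- and the prefix sums of b are bounded by those of c, then a · b ≤ a · c.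
-- Combined with the fact that rearranging a non-increasing vector can only lower
-- its prefix sums, this is the rearrangement inequality.
-- Upper bound: u · x ≤ Σ |u|_[i] |x|_[i] by rearrangement, and since the prefix
-- sums of |x|_[·] are at most M times those of w, where M is the claimed maximum,
-- this is at most M Ω(u).
-- Attainment: if the maximum is attained at i, let u have entries τ_i sign(x_k) on
-- the i components of x of largest magnitude and 0 elsewhere.
module Submission where

open import Defs
open import Algebra.Bundles using (CommutativeRing)
open import Data.Fin.Base as Fin using (Fin; zero; suc; cast; toℕ)
open import Data.Fin.Permutation
  using (Permutation′; _⟨$⟩ʳ_; _⟨$⟩ˡ_; _∘ₚ_; flip; cast-id; inverseˡ; inverseʳ)
open import Data.Fin.Properties using (toℕ-cast)
open import Data.List.Base using (lookup)
open import Data.List.Properties using (length-tabulate; lookup-tabulate)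
open import Data.List.Membership.Propositional.Properties using (∈-tabulate⁻)
open import Data.List.Relation.Binary.Permutation.Propositional using (↭⇒↭ₛ)
open import Data.List.Relation.Binary.Permutation.Homogeneous using (onIndices)
open import Data.List.Relation.Binary.Permutation.Setoid.Properties using (onIndices-lookup)
open import Data.List.Relation.Unary.All.Properties using (tabulate⁻)
open import Data.List.Relation.Unary.Sorted.TotalOrder.Properties using (lookup-mono-≤)
open import Data.Nat.Base as ℕ using (ℕ; NonZero; z≤n; s≤s)
open import Data.Product.Base using (∃; _×_; _,_; proj₁; proj₂)
open import Data.Sum.Base using (_⊎_; inj₁; inj₂)
open import Data.Vec.Functional using (Vector; tail; toList)
open import Function.Base using (_∘_)
open import Level using (Level)
open import Relation.Binary.Bundles using (DecTotalOrder)
open import Relation.Binary.PropositionalEquality.Core as ≡ using (_≡_)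
import Relation.Binary.PropositionalEquality.Properties as ≡
open import Relation.Nullary.Negation.Core using (¬_; contradiction)
import Algebra.Construct.NaturalChoice.Max
import Algebra.Properties.CommutativeSemigroup
import Algebra.Properties.Ring
import Algebra.Properties.Semiring.Sum
import Data.List.Extrema
import Data.List.Sort
import Relation.Binary.Reasoning.PartialOrder

-- Sorting a vector as a permutation of its indices.

module _ {c ℓ₁ ℓ₂ : Level} (O : DecTotalOrder c ℓ₁ ℓ₂) where
  open DecTotalOrder O using (Carrier; _≤_; totalOrder)
  open Data.List.Sort O using (sort; sort-↭; sort-↗)

  sortVector-permutes : ∀ {n} (v : Vector Carrier n) →
    ∃ λ (π : Permutation′ n) → ∀ i → sortVector O v i ≡ v (π ⟨$⟩ʳ i)
  sortVector-permutes {n} v = π , eq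
    where
    p = ↭⇒↭ₛ (sort-↭ (toList v))
    π : Permutation′ n
    π = cast-id (length-sort O v)
        ∘ₚ onIndices p
        ∘ₚ cast-id (length-tabulate v)
    eq : ∀ i → sortVector O v i ≡ v (π ⟨$⟩ʳ i)
    eq i = ≡.trans
      (onIndices-lookup (≡.setoid Carrier) p (cast (length-sort O v) i))
      (≡.trans
        -- The list index is rewritten as a cast there and back, the form in which `lookup-tabulate`
        -- applies.
        (≡.cong (lookup (toList v)) (≡.sym (inverseˡ (cast-id (length-tabulate v)))))
        (lookup-tabulate v (π ⟨$⟩ʳ i)))

  sortVector-mono : ∀ {n} (v : Vector Carrier n) {i j} → i Fin.≤ j →
                    sortVector O v i ≤ sortVector O v j
  sortVector-mono v {i} {j} i≤j = lookup-mono-≤ totalOrder (sort-↗ (toList v))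
    (≡.subst₂ ℕ._≤_ (≡.sym (toℕ-cast (length-sort O v) i))
                    (≡.sym (toℕ-cast (length-sort O v) j)) i≤j)

module _ {c ℓ₁ ℓ₂ : Level} (ℝ : CompleteOrderedField c ℓ₁ ℓ₂) where

  open CompleteOrderedField ℝ
  open OWL ℝ
  open CommutativeRing commutativeRing using
    ( ring; semiring; *-commutativeSemigroup
    ; refl; sym; trans; reflexive; +-cong; +-congˡ; +-congʳ; *-cong; *-congˡ; *-congʳ
    ; +-assoc; +-comm; *-assoc; *-comm; +-identityˡ; +-identityʳ; *-identityˡ; *-identityʳ
    ; -‿inverseˡ; -‿inverseʳ; distribˡ; distribʳ; zeroˡ; zeroʳ; -‿cong )
  open Algebra.Properties.Ring ring using (-‿distribˡ-*; -‿distribʳ-*; -‿involutive)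
  open Algebra.Properties.Semiring.Sum semiring
    using (sum; sum-cong-≋; ∑-distrib-+; ∑-permute; *-distribˡ-sum)
  open Algebra.Construct.NaturalChoice.Max totalOrder using (x≤x⊔y; x≤y⊔x; ⊔-lub)
  open Algebra.Properties.CommutativeSemigroup *-commutativeSemigroup using (x∙yz≈y∙xz)
  open DecTotalOrder decTotalOrder using (poset; total; antisym; ≤-respˡ-≈; ≤-respʳ-≈)
    renaming (refl to ≤-refl; reflexive to ≤-reflexive; trans to ≤-trans)
  open Relation.Binary.Reasoning.PartialOrder poset

  -- Arithmetic of ordered fields.

  +-monoʳ-≤ : ∀ x {y z} → y ≤ z → x + y ≤ x + z
  +-monoʳ-≤ x {y} {z} y≤z = begin
    x + y  ≈⟨ +-comm x y ⟩
    y + x  ≤⟨ +-monoˡ-≤ x y≤z ⟩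
    z + x  ≈⟨ +-comm z x ⟩
    x + z  ∎

  +-mono-≤ : ∀ {x y u v} → x ≤ y → u ≤ v → x + u ≤ y + v
  +-mono-≤ x≤y u≤v = ≤-trans (+-monoˡ-≤ _ x≤y) (+-monoʳ-≤ _ u≤v)

  x+y-y≈x : ∀ x y → x + y + - y ≈ x
  x+y-y≈x x y = trans (+-assoc x y (- y)) (trans (+-congˡ (-‿inverseʳ y)) (+-identityʳ x))

  x+[y-x]≈y : ∀ x y → x + (y + - x) ≈ y
  x+[y-x]≈y x y = trans (sym (+-assoc x y (- x))) (trans (+-congʳ (+-comm x y)) (x+y-y≈x y x))

  +-cancelʳ-≤ : ∀ x {y z} → y + x ≤ z + x → y ≤ z
  +-cancelʳ-≤ x {y} {z} y+x≤z+x = begin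
    y            ≈⟨ x+y-y≈x y x ⟨
    y + x + - x  ≤⟨ +-monoˡ-≤ (- x) y+x≤z+x ⟩
    z + x + - x  ≈⟨ x+y-y≈x z x ⟩
    z            ∎

  0≤y⇒x≤x+y : ∀ {x y} → 0# ≤ y → x ≤ x + y
  0≤y⇒x≤x+y {x} 0≤y = ≤-respˡ-≈ (+-identityʳ x) (+-monoʳ-≤ x 0≤y)

  x≤x+y⇒0≤y : ∀ {x y} → x ≤ x + y → 0# ≤ y
  x≤x+y⇒0≤y {x} {y} x≤x+y = +-cancelʳ-≤ x (begin
    0# + x  ≈⟨ +-identityˡ x ⟩
    x       ≤⟨ x≤x+y ⟩
    x + y   ≈⟨ +-comm x y ⟩
    y + x   ∎)

  x≤y⇒0≤y-x : ∀ {x y} → x ≤ y → 0# ≤ y + - x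
  x≤y⇒0≤y-x {x} {y} x≤y = x≤x+y⇒0≤y (≤-respʳ-≈ (sym (x+[y-x]≈y x y)) x≤y)

  x≤0⇒0≤-x : ∀ {x} → x ≤ 0# → 0# ≤ - x
  x≤0⇒0≤-x {x} x≤0 = ≤-respʳ-≈ (+-identityˡ (- x)) (x≤y⇒0≤y-x x≤0)

  0≤x⇒-x≤x : ∀ {x} → 0# ≤ x → - x ≤ x
  0≤x⇒-x≤x {x} 0≤x = ≤-trans (≤-respʳ-≈ (-‿inverseˡ x) (0≤y⇒x≤x+y 0≤x)) 0≤x

  -x*-y≈x*y : ∀ x y → - x * - y ≈ x * y
  -x*-y≈x*y x y = trans (sym (-‿distribʳ-* (- x) y))
    (trans (-‿cong (sym (-‿distribˡ-* x y))) (-‿involutive (x * y)))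

  *-monoˡ-≤ : ∀ {z x y} → 0# ≤ z → x ≤ y → z * x ≤ z * y
  *-monoˡ-≤ {z} {x} {y} 0≤z x≤y = begin
    z * x                   ≤⟨ 0≤y⇒x≤x+y (*-nonNegative 0≤z (x≤y⇒0≤y-x x≤y)) ⟩
    z * x + z * (y + - x)   ≈⟨ distribˡ z x _ ⟨
    z * (x + (y + - x))     ≈⟨ *-congˡ (x+[y-x]≈y x y) ⟩
    z * y                   ∎

  *-monoʳ-≤ : ∀ {z x y} → 0# ≤ z → x ≤ y → x * z ≤ y * z
  *-monoʳ-≤ {z} {x} {y} 0≤z x≤y =
    ≤-respˡ-≈ (*-comm z x) (≤-respʳ-≈ (*-comm z y) (*-monoˡ-≤ 0≤z x≤y))

  0≤1 : 0# ≤ 1#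
  0≤1 with total 0# 1#
  ... | inj₁ p = p
  ... | inj₂ p = ≤-respʳ-≈ (trans (-x*-y≈x*y 1# 1#) (*-identityˡ 1#))
                           (*-nonNegative (x≤0⇒0≤-x p) (x≤0⇒0≤-x p))

  -- A non-positive inverse would make the product `x * x ⁻¹`, which is `1#`, non-positive.
  ⁻¹-nonNegative : ∀ {x} → 0# ≤ x → ¬ (x ≈ 0#) → 0# ≤ x ⁻¹
  ⁻¹-nonNegative {x} 0≤x x≉0 with total 0# (x ⁻¹)
  ... | inj₁ p = p
  ... | inj₂ p = contradiction (antisym 1≤0 0≤1) 1≉0
    where
    1≤0 : 1# ≤ 0#
    1≤0 = begin
      1#        ≈⟨ ⁻¹-inverseʳ x x≉0 ⟨
      x * x ⁻¹  ≤⟨ *-monoˡ-≤ 0≤x p ⟩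
      x * 0#    ≈⟨ zeroʳ x ⟩
      0#        ∎

  -- The right side exceeds the left by `(y - x) * (t - s)`. This is the two-term rearrangement
  -- inequality.
  exchange : ∀ {x y s t} → x ≤ y → s ≤ t → x * t + y * s ≤ x * s + y * t
  exchange {x} {y} {s} {t} x≤y s≤t = begin
    x * t + y * s                          ≈⟨ +-congʳ (*-congˡ (x+[y-x]≈y s t)) ⟨
    x * (s + d) + y * s                    ≈⟨ +-congʳ (distribˡ x s d) ⟩
    x * s + x * d + y * s                  ≈⟨ +-assoc _ _ _ ⟩
    x * s + (x * d + y * s)                ≤⟨ +-monoʳ-≤ _ (+-monoˡ-≤ _ (*-monoʳ-≤ (x≤y⇒0≤y-x s≤t) x≤y)) ⟩
    x * s + (y * d + y * s)                ≈⟨ +-congˡ (distribˡ y d s) ⟨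
    x * s + y * (d + s)                    ≈⟨ +-congˡ (*-congˡ (trans (+-comm d s) (x+[y-x]≈y s t))) ⟩
    x * s + y * t                          ∎
    where d = t + - s

  -- Absolute values and signs.

  x≤∣x∣ : ∀ x → x ≤ ∣ x ∣
  x≤∣x∣ x = x≤x⊔y x (- x)

  -x≤∣x∣ : ∀ x → - x ≤ ∣ x ∣
  -x≤∣x∣ x = x≤y⊔x x (- x)

  0≤∣x∣ : ∀ x → 0# ≤ ∣ x ∣
  0≤∣x∣ x with total 0# x
  ... | inj₁ 0≤x = ≤-trans 0≤x (x≤∣x∣ x)
  ... | inj₂ x≤0 = ≤-trans (x≤0⇒0≤-x x≤0) (-x≤∣x∣ x)

  x*y≤∣x∣*∣y∣ : ∀ x y → x * y ≤ ∣ x ∣ * ∣ y ∣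
  x*y≤∣x∣*∣y∣ x y with total 0# y
  ... | inj₁ 0≤y = ≤-trans (*-monoʳ-≤ 0≤y (x≤∣x∣ x)) (*-monoˡ-≤ (0≤∣x∣ x) (x≤∣x∣ y))
  ... | inj₂ y≤0 = begin
    x * y          ≈⟨ -x*-y≈x*y x y ⟨
    - x * - y      ≤⟨ *-monoʳ-≤ (x≤0⇒0≤-x y≤0) (-x≤∣x∣ x) ⟩
    ∣ x ∣ * - y    ≤⟨ *-monoˡ-≤ (0≤∣x∣ x) (-x≤∣x∣ y) ⟩
    ∣ x ∣ * ∣ y ∣  ∎

  -- The product of `e` with a sign of `x` that is always 1 or -1. At zero either sign may be taken,
  -- which is harmless because the result is only bounded in magnitude or multiplied by `x`.
  withSignOf : Carrier → Carrier → Carrier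
  withSignOf x e with total 0# x
  ... | inj₁ _ = e
  ... | inj₂ _ = - e

  ∣withSignOf∣≤ : ∀ x {e} → 0# ≤ e → ∣ withSignOf x e ∣ ≤ e
  ∣withSignOf∣≤ x {e} 0≤e with total 0# x
  ... | inj₁ _ = ⊔-lub ≤-refl (0≤x⇒-x≤x 0≤e)
  ... | inj₂ _ = ⊔-lub (0≤x⇒-x≤x 0≤e) (≤-reflexive (-‿involutive e))

  withSignOf-* : ∀ x e → withSignOf x e * x ≈ e * ∣ x ∣
  withSignOf-* x e with total 0# x
  ... | inj₁ 0≤x = *-congˡ (antisym (x≤∣x∣ x) (⊔-lub ≤-refl (0≤x⇒-x≤x 0≤x)))
  ... | inj₂ x≤0 = trans (sym (-‿distribˡ-* e x)) (trans (-‿distribʳ-* e x)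
                     (*-congˡ (antisym (-x≤∣x∣ x) (⊔-lub (≤-trans x≤0 (x≤0⇒0≤-x x≤0)) ≤-refl))))

  -- Finite sums and Abel summation.

  sum-mono : ∀ {n} {f g : ℝ^ n} → (∀ i → f i ≤ g i) → sum f ≤ sum g
  sum-mono {ℕ.zero}  f≤g = ≤-refl
  sum-mono {ℕ.suc n} f≤g = +-mono-≤ (f≤g zero) (sum-mono (f≤g ∘ suc))

  sum-nonNegative : ∀ {n} {f : ℝ^ n} → (∀ i → 0# ≤ f i) → 0# ≤ sum f
  sum-nonNegative {ℕ.zero}  0≤f = ≤-refl
  sum-nonNegative {ℕ.suc n} 0≤f =
    ≤-respˡ-≈ (+-identityˡ 0#) (+-mono-≤ (0≤f zero) (sum-nonNegative (0≤f ∘ suc)))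

  Antitone : ∀ {n} → ℝ^ n → Set ℓ₂
  Antitone a = ∀ i j → i Fin.≤ j → a j ≤ a i

  -- The induction carries the mass s of the entries already passed, weighted by a
  -- bound A on the remaining weights.
  abel-nonNegative : ∀ {n} {a d : ℝ^ n} {A s} → MonotoneNonNegative a →
    0# ≤ A → (∀ i → a i ≤ A) → 0# ≤ s → (∀ i → 0# ≤ s + sum (leading d i)) →
    0# ≤ A * s + a · d
  abel-nonNegative {ℕ.zero} {A = A} {s} _ 0≤A _ 0≤s _ =
    ≤-respʳ-≈ (sym (+-identityʳ (A * s))) (*-nonNegative 0≤A 0≤s)
  abel-nonNegative {ℕ.suc n} {a} {d} {A} {s} (a↓ , 0≤a) 0≤A a≤A 0≤s prefix = begin
    0#
      ≤⟨ abel-nonNegative {a = tail a} {d = tail d}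
           ((λ i j i≤j → a↓ (suc i) (suc j) (s≤s i≤j)) , 0≤a ∘ suc)
           (0≤a zero) (λ i → a↓ zero (suc i) z≤n)
           (≤-respʳ-≈ (+-congˡ (+-identityʳ d₀)) (prefix zero))
           (λ i → ≤-respʳ-≈ (sym (+-assoc s d₀ _)) (prefix (suc i))) ⟩
    a₀ * (s + d₀) + tail a · tail d
      ≈⟨ +-congʳ (distribˡ a₀ s d₀) ⟩
    a₀ * s + a₀ * d₀ + tail a · tail d
      ≈⟨ +-assoc _ _ _ ⟩
    a₀ * s + a · d
      ≤⟨ +-monoˡ-≤ _ (*-monoʳ-≤ 0≤s (a≤A zero)) ⟩
    A * s + a · d
      ∎
    where
    a₀ = a zero
    d₀ = d zero

  sum-+ : ∀ {n} {f g h : ℝ^ n} → (∀ i → f i + g i ≈ h i) → sum f + sum g ≈ sum h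
  sum-+ {f = f} {g} f+g≈h = trans (sym (∑-distrib-+ f g)) (sum-cong-≋ f+g≈h)

  -- The difference `d` of `c` and `b` has non-negative prefix sums, so Abel summation makes `a · d`
  -- non-negative.
  ·-mono-prefix : ∀ {n} {a b c : ℝ^ n} → MonotoneNonNegative a →
    (∀ i → sum (leading b i) ≤ sum (leading c i)) → a · b ≤ a · c
  ·-mono-prefix {ℕ.zero} _ _ = ≤-refl
  ·-mono-prefix {ℕ.suc n} {a} {b} {c} a↓@(anti , 0≤a) b≤c = begin
    a · b          ≤⟨ 0≤y⇒x≤x+y 0≤a·d ⟩
    a · b + a · d  ≈⟨ sum-+ (λ i → trans (sym (distribˡ (a i) (b i) (d i)))
                                         (*-congˡ (x+[y-x]≈y (b i) (c i)))) ⟩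
    a · c          ∎
    where
    d : ℝ^ (ℕ.suc n)
    d i = c i + - b i
    prefix : ∀ i → 0# ≤ 0# + sum (leading d i)
    prefix i = ≤-respʳ-≈ (sym (+-identityˡ _)) (x≤x+y⇒0≤y
      (≤-respʳ-≈ (sym (sum-+ {g = leading d i} λ j → x+[y-x]≈y (leading b i j) (leading c i j))) (b≤c i)))
    0≤a·d : 0# ≤ a · d
    0≤a·d = begin
      -- The induction starts with no mass carried, `s` being `0#`, and with the largest weight
      -- `a zero` as the bound `A`.
      0#                   ≤⟨ abel-nonNegative {d = d} a↓ (0≤a zero) (λ i → anti zero i z≤n) ≤-refl prefix ⟩
      a zero * 0# + a · d  ≈⟨ +-congʳ (zeroʳ (a zero)) ⟩
      0# + a · d           ≈⟨ +-identityˡ _ ⟩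
      a · d                ∎

  -- Rearrangement inequalities.

  indicator : ∀ {n} → Fin n → ℝ^ n
  indicator i       zero    = 1#
  indicator zero    (suc j) = 0#
  indicator (suc i) (suc j) = indicator i j

  -- Each value comes with the weak index inequality that antitonicity of a vector consumes.
  indicator-cases : ∀ {n} (i j : Fin n) →
    (j Fin.≤ i × indicator i j ≡ 1#) ⊎ (i Fin.≤ j × indicator i j ≡ 0#)
  indicator-cases i       zero    = inj₁ (z≤n , ≡.refl)
  indicator-cases zero    (suc j) = inj₂ (z≤n , ≡.refl)
  indicator-cases (suc i) (suc j) with indicator-cases i j
  ... | inj₁ (j≤i , eq) = inj₁ (s≤s j≤i , eq)
  ... | inj₂ (i≤j , eq) = inj₂ (s≤s i≤j , eq)

  0≤indicator : ∀ {n} (i j : Fin n) → 0# ≤ indicator i j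
  0≤indicator i j with indicator-cases i j
  ... | inj₁ (_ , eq) = ≤-respʳ-≈ (reflexive (≡.sym eq)) 0≤1
  ... | inj₂ (_ , eq) = ≤-reflexive (reflexive (≡.sym eq))

  indicator≤1 : ∀ {n} (i j : Fin n) → indicator i j ≤ 1#
  indicator≤1 i j with indicator-cases i j
  ... | inj₁ (_ , eq) = ≤-reflexive (reflexive eq)
  ... | inj₂ (_ , eq) = ≤-respˡ-≈ (reflexive (≡.sym eq)) 0≤1

  indicator-antitone : ∀ {n} (i : Fin n) → Antitone (indicator i)
  indicator-antitone i       zero    k       _         = indicator≤1 i k
  indicator-antitone zero    (suc j) (suc k) _         = ≤-refl
  indicator-antitone (suc i) (suc j) (suc k) (s≤s j≤k) = indicator-antitone i j k j≤k

  -- Turns a prefix sum, position `i` included, into a sum over all of `Fin n`, where re-indexing by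
  -- a permutation is available.
  indicator-· : ∀ {n} (i : Fin n) (v : ℝ^ n) → indicator i · v ≈ sum (leading v i)
  indicator-· zero    v = +-cong (*-identityˡ (v zero))
    (trans (sym (*-distribˡ-sum 0# (tail v))) (zeroˡ (sum (tail v))))
  indicator-· (suc i) v = +-cong (*-identityˡ (v zero)) (indicator-· i (tail v))

  -- (1[j ≤ i] − 1[k ≤ i]) (b i − b k) ≥ 0, summed over j with k = π j.
  sum-leading-rearrange : ∀ {n} {b : ℝ^ n} → Antitone b → (π : Permutation′ n) (i : Fin n) →
    sum (leading (b ∘ (π ⟨$⟩ʳ_)) i) ≤ sum (leading b i)
  sum-leading-rearrange {n} {b} b↓ π i = begin
    sum (leading (b ∘ (π ⟨$⟩ʳ_)) i)  ≈⟨ indicator-· i (b ∘ (π ⟨$⟩ʳ_)) ⟨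
    e · (b ∘ (π ⟨$⟩ʳ_))              ≤⟨ +-cancelʳ-≤ E summed ⟩
    e · b                            ≈⟨ indicator-· i b ⟩
    sum (leading b i)                ∎
    where
    e = indicator i
    -- The cross term. Since `b i` is constant, re-indexing by `π` leaves it unchanged, so it
    -- cancels from both sides.
    E = sum (λ j → e j * b i)
    pairwise : ∀ j k → e j * b k + e k * b i ≤ e k * b k + e j * b i
    pairwise j k with indicator-cases i k
    ... | inj₁ (k≤i , eq) = ≤-respʳ-≈ (+-comm _ _)
      (exchange (≤-respʳ-≈ (reflexive (≡.sym eq)) (indicator≤1 i j)) (b↓ k i k≤i))
    ... | inj₂ (i≤k , eq) = ≤-respˡ-≈ (+-comm _ _)
      (exchange (≤-respˡ-≈ (reflexive (≡.sym eq)) (0≤indicator i j)) (b↓ i k i≤k))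
    summed : e · (b ∘ (π ⟨$⟩ʳ_)) + E ≤ e · b + E
    summed = begin
      e · (b ∘ (π ⟨$⟩ʳ_)) + E
        ≈⟨ +-congˡ (∑-permute (λ j → e j * b i) π) ⟩
      e · (b ∘ (π ⟨$⟩ʳ_)) + sum (λ j → e (π ⟨$⟩ʳ j) * b i)
        ≈⟨ ∑-distrib-+ (λ j → e j * b (π ⟨$⟩ʳ j)) (λ j → e (π ⟨$⟩ʳ j) * b i) ⟨
      sum (λ j → e j * b (π ⟨$⟩ʳ j) + e (π ⟨$⟩ʳ j) * b i)
        ≤⟨ sum-mono (λ j → pairwise j (π ⟨$⟩ʳ j)) ⟩
      sum (λ j → e (π ⟨$⟩ʳ j) * b (π ⟨$⟩ʳ j) + e j * b i)
        ≈⟨ ∑-distrib-+ (λ j → e (π ⟨$⟩ʳ j) * b (π ⟨$⟩ʳ j)) (λ j → e j * b i) ⟩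
      sum (λ j → e (π ⟨$⟩ʳ j) * b (π ⟨$⟩ʳ j)) + E
        ≈⟨ +-congʳ (∑-permute (λ j → e j * b j) π) ⟨
      e · b + E
        ∎

  -- Permuting `b` can only lower its prefix sums, and Abel summation carries this over to the
  -- products with `a`.
  rearrangement : ∀ {n} {a b : ℝ^ n} → MonotoneNonNegative a → Antitone b →
    (π : Permutation′ n) → a · (b ∘ (π ⟨$⟩ʳ_)) ≤ a · b
  rearrangement a↓ b↓ π = ·-mono-prefix a↓ (sum-leading-rearrange b↓ π)

  ·-≤-sorted : ∀ {n} {a b : ℝ^ n} (π ρ : Permutation′ n) →
    MonotoneNonNegative (a ∘ (π ⟨$⟩ʳ_)) → Antitone (b ∘ (ρ ⟨$⟩ʳ_)) →
    a · b ≤ (a ∘ (π ⟨$⟩ʳ_)) · (b ∘ (ρ ⟨$⟩ʳ_))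
  ·-≤-sorted {a = a} {b} π ρ a↓ b↓ = begin
    a · b
      ≈⟨ ∑-permute (λ i → a i * b i) π ⟩
    sum (λ i → a (π ⟨$⟩ʳ i) * b (π ⟨$⟩ʳ i))
      ≈⟨ sum-cong-≋ (λ i → *-congˡ {a (π ⟨$⟩ʳ i)} (reflexive (≡.cong b (inverseʳ ρ)))) ⟨
    sum (λ i → a (π ⟨$⟩ʳ i) * b (ρ ⟨$⟩ʳ (ρ ⟨$⟩ˡ (π ⟨$⟩ʳ i))))
      -- After re-indexing by `π`, the second factor is the sorted vector `b ∘ (ρ ⟨$⟩ʳ_)` permuted
      -- by `π` followed by the inverse of `ρ`.
      ≤⟨ rearrangement a↓ b↓ (π ∘ₚ flip ρ) ⟩
    (a ∘ (π ⟨$⟩ʳ_)) · (b ∘ (ρ ⟨$⟩ʳ_))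
      ∎

  -- Finite maxima and positivity of prefix sums.

  ≤-maximum : ∀ {n} .{{_ : NonZero n}} (v : ℝ^ n) i → v i ≤ maximum v
  ≤-maximum {ℕ.suc n} v zero    = Data.List.Extrema.⊥≤max totalOrder (v zero) (toList (tail v))
  ≤-maximum {ℕ.suc n} v (suc i) =
    tabulate⁻ (Data.List.Extrema.xs≤max totalOrder (v zero) (toList (tail v))) i

  maximum-attained : ∀ {n} .{{_ : NonZero n}} (v : ℝ^ n) → ∃ λ i → maximum v ≡ v i
  maximum-attained {ℕ.suc n} v
    -- `max` is `argmax` of the identity. Its default `v zero` is itself an entry of `v`, so both
    -- outcomes give an index.
    with Data.List.Extrema.argmax-sel totalOrder (λ y → y) (v zero) (toList (tail v))
  ... | inj₁ eq = zero , eq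
  ... | inj₂ m∈ with ∈-tabulate⁻ m∈
  ...   | i , eq = suc i , eq

  ∣∣[]-permutes : ∀ {n} (u : ℝ^ n) →
    ∃ λ (π : Permutation′ n) → ∀ i → ∣ u ∣[ i ] ≡ ∣ u (π ⟨$⟩ʳ i) ∣
  ∣∣[]-permutes u = sortVector-permutes ≥-decTotalOrder (∣_∣ ∘ u)

  leading-nonNegative : ∀ {n} {v : ℝ^ n} → (∀ i → 0# ≤ v i) → ∀ i → 0# ≤ sum (leading v i)
  leading-nonNegative {v = v} 0≤v i = sum-nonNegative {f = leading v i} (λ j → 0≤v _)

  -- Every prefix sum dominates the first and largest weight; if one vanished, all weights would.
  leading-nonZero : ∀ {n} {w : ℝ^ n} → MonotoneNonNegative w → ¬ IsZero w →
                    ∀ i → ¬ (sum (leading w i) ≈ 0#)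
  leading-nonZero {ℕ.suc n} {w} (w↓ , 0≤w) w≉0 i W≈0 = w≉0 λ j → antisym (w≤0 j) (0≤w j)
    where
    w₀≤W : w zero ≤ sum (leading w i)
    w₀≤W = 0≤y⇒x≤x+y (sum-nonNegative {f = tail (leading w i)} (λ j → 0≤w _))
    w≤0 : ∀ j → w j ≤ 0#
    w≤0 j = ≤-trans (w↓ zero j z≤n) (≤-respʳ-≈ W≈0 w₀≤W)

  -- The upper bound on the dual norm.

  module _ (n : ℕ) .{{_ : NonZero n}} (w : ℝ^ n)
           (w↓ : MonotoneNonNegative w) (w≉0 : ¬ IsZero w) (x : ℝ^ n) where

    W : ℝ^ n
    W i = sum (leading w i)

    0≤τ : ∀ i → 0# ≤ τ w i
    0≤τ i = ⁻¹-nonNegative (leading-nonNegative (proj₂ w↓) i) (leading-nonZero w↓ w≉0 i)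

    W*τ≈1 : ∀ i → W i * τ w i ≈ 1#
    W*τ≈1 i = ⁻¹-inverseʳ (W i) (leading-nonZero w↓ w≉0 i)

    ρ : Permutation′ n
    ρ = proj₁ (sortVector-permutes magnitude-≥-decTotalOrder x)

    -- Taking magnitudes after the signed sort makes `sum (leading y i)` definitionally
    -- `‖ x ₍ i ₎ ‖₁`.
    y : ℝ^ n
    y = ∣_∣ ∘ sortVector magnitude-≥-decTotalOrder x

    y≡ : ∀ i → y i ≡ ∣ x (ρ ⟨$⟩ʳ i) ∣
    y≡ i = ≡.cong ∣_∣ (proj₂ (sortVector-permutes magnitude-≥-decTotalOrder x) i)

    y-antitone : Antitone y
    -- Monotone for the flipped order of magnitudes unfolds to antitone.
    y-antitone i j i≤j = sortVector-mono magnitude-≥-decTotalOrder x i≤j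

    values : ℝ^ n
    values i = τ w i * ‖ x ₍ i ₎ ‖₁

    M : Carrier
    M = maximum values

    0≤M : 0# ≤ M
    0≤M with maximum-attained values
    ... | i , eq = ≤-respʳ-≈ (reflexive (≡.sym eq))
                     (*-nonNegative (0≤τ i) (leading-nonNegative {v = y} (λ j → 0≤∣x∣ _) i))

    prefix-bound : ∀ i → sum (leading y i) ≤ sum (leading (λ j → M * w j) i)
    prefix-bound i = begin
      S                          ≈⟨ *-identityˡ S ⟨
      -- Inserting `W i * τ w i` exposes `values i`, which `M` bounds.
      1# * S                     ≈⟨ *-congʳ (W*τ≈1 i) ⟨
      W i * τ w i * S            ≈⟨ *-assoc _ _ _ ⟩
      W i * values i             ≤⟨ *-monoˡ-≤ (leading-nonNegative (proj₂ w↓) i) (≤-maximum values i) ⟩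
      W i * M                    ≈⟨ *-comm _ _ ⟩
      M * W i                    ≈⟨ *-distribˡ-sum M (leading w i) ⟩
      sum (leading (λ j → M * w j) i) ∎
      where S = sum (leading y i)

    upper-bound : ∀ u → Ω w u ≤ 1# → u · x ≤ M
    upper-bound u Ωu≤1 = begin
      u · x
        ≤⟨ sum-mono (λ i → x*y≤∣x∣*∣y∣ (u i) (x i)) ⟩
      (∣_∣ ∘ u) · (∣_∣ ∘ x)
        ≤⟨ ·-≤-sorted π ρ ∣u∣↓ ∣x∣↓ ⟩
      (∣_∣ ∘ u ∘ (π ⟨$⟩ʳ_)) · (∣_∣ ∘ x ∘ (ρ ⟨$⟩ʳ_))
        -- Here the sorted magnitudes of `u` are the monotone weights, and `w` enters as the vector
        -- being compared.
        ≤⟨ ·-mono-prefix ∣u∣↓ prefix ⟩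
      (∣_∣ ∘ u ∘ (π ⟨$⟩ʳ_)) · (λ i → M * w i)
        ≈⟨ sum-cong-≋ (λ i → trans (x∙yz≈y∙xz _ M (w i))
             (*-congˡ (trans (*-comm _ (w i)) (*-congˡ (reflexive (≡.sym (eq i))))))) ⟩
      sum (λ i → M * (w i * ∣ u ∣[ i ]))
        ≈⟨ *-distribˡ-sum M (λ i → w i * ∣ u ∣[ i ]) ⟨
      M * Ω w u
        ≤⟨ *-monoˡ-≤ 0≤M Ωu≤1 ⟩
      M * 1#
        ≈⟨ *-identityʳ M ⟩
      M
        ∎
      where
      π = proj₁ (∣∣[]-permutes u)
      eq = proj₂ (∣∣[]-permutes u)
      ∣u∣↓ : MonotoneNonNegative (∣_∣ ∘ u ∘ (π ⟨$⟩ʳ_))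
      ∣u∣↓ = (λ i j i≤j → ≡.subst₂ _≤_ (eq j) (eq i)
                            (sortVector-mono ≥-decTotalOrder (∣_∣ ∘ u) i≤j))
           , λ i → 0≤∣x∣ _
      ∣x∣↓ : Antitone (∣_∣ ∘ x ∘ (ρ ⟨$⟩ʳ_))
      ∣x∣↓ i j i≤j = ≡.subst₂ _≤_ (y≡ j) (y≡ i) (y-antitone i j i≤j)
      prefix : ∀ i → sum (leading (∣_∣ ∘ x ∘ (ρ ⟨$⟩ʳ_)) i) ≤ sum (leading (λ j → M * w j) i)
      prefix i = ≤-respˡ-≈
        (sum-cong-≋ {ℕ.suc (toℕ i)} {leading y i} (λ j → reflexive (y≡ _))) (prefix-bound i)

    -- A vector attaining the value at index `i`.

    module _ (i : Fin n) where

      weight : ℝ^ n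
      weight j = τ w i * indicator i j

      -- `weight` is indexed by rank; `ρ ⟨$⟩ˡ k` is the rank of component `k` of `x` by magnitude.
      extremal : ℝ^ n
      extremal k = withSignOf (x k) (weight (ρ ⟨$⟩ˡ k))

      -- The sorted order of `extremal` need not be identified: whichever permutation `σ` sorts it,
      -- its magnitudes are bounded by a rearrangement of `weight`, which pairs with `w` to at most
      -- `w · weight`.
      Ω-extremal : Ω w extremal ≤ 1#
      Ω-extremal = begin
        Ω w extremal
          ≤⟨ sum-mono (λ j → *-monoˡ-≤ (proj₂ w↓ j) (∣extremal∣≤ j)) ⟩
        w · (weight ∘ ((σ ∘ₚ flip ρ) ⟨$⟩ʳ_))
          ≤⟨ rearrangement w↓ (λ j k j≤k → *-monoˡ-≤ (0≤τ i) (indicator-antitone i j k j≤k))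
               (σ ∘ₚ flip ρ) ⟩
        w · weight
          ≈⟨ sum-cong-≋ (λ j → trans (x∙yz≈y∙xz (w j) (τ w i) _) (*-congˡ (*-comm _ _))) ⟩
        sum (λ j → τ w i * (indicator i j * w j))
          ≈⟨ *-distribˡ-sum (τ w i) (λ j → indicator i j * w j) ⟨
        τ w i * (indicator i · w)
          ≈⟨ *-congˡ (indicator-· i w) ⟩
        τ w i * W i
          ≈⟨ trans (*-comm _ _) (W*τ≈1 i) ⟩
        1#
          ∎
        where
        σ = proj₁ (∣∣[]-permutes extremal)
        eq = proj₂ (∣∣[]-permutes extremal)
        ∣extremal∣≤ : ∀ j → ∣ extremal ∣[ j ] ≤ weight (ρ ⟨$⟩ˡ (σ ⟨$⟩ʳ j))
        ∣extremal∣≤ j = ≤-respˡ-≈ (reflexive (≡.sym (eq j)))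
          (∣withSignOf∣≤ (x (σ ⟨$⟩ʳ j)) (*-nonNegative (0≤τ i) (0≤indicator i (ρ ⟨$⟩ˡ (σ ⟨$⟩ʳ j)))))

      extremal-· : extremal · x ≈ values i
      extremal-· = begin-equality
        extremal · x
          ≈⟨ sum-cong-≋ (λ k → withSignOf-* (x k) (weight (ρ ⟨$⟩ˡ k))) ⟩
        sum (λ k → weight (ρ ⟨$⟩ˡ k) * ∣ x k ∣)
          -- Summing by rank cancels `ρ` against its inverse and turns the magnitudes of `x` into
          -- `y`.
          ≈⟨ ∑-permute (λ k → weight (ρ ⟨$⟩ˡ k) * ∣ x k ∣) ρ ⟩
        sum (λ j → weight (ρ ⟨$⟩ˡ (ρ ⟨$⟩ʳ j)) * ∣ x (ρ ⟨$⟩ʳ j) ∣)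
          ≈⟨ sum-cong-≋ (λ j → trans (*-cong (reflexive (≡.cong weight (inverseˡ ρ)))
                                            (reflexive (≡.sym (y≡ j))))
                                     (*-assoc _ _ _)) ⟩
        sum (λ j → τ w i * (indicator i j * y j))
          ≈⟨ *-distribˡ-sum (τ w i) (λ j → indicator i j * y j) ⟨
        τ w i * (indicator i · y)
          ≈⟨ *-congˡ (indicator-· i y) ⟩
        values i
          ∎

    isDualNorm : IsDualNorm (Ω w) x M
    isDualNorm with maximum-attained values
    ... | i , eq = (extremal i , Ω-extremal i , trans (reflexive eq) (sym (extremal-· i)))
                 , λ { r (u , Ωu≤1 , r≈) → ≤-respˡ-≈ (sym r≈) (upper-bound u Ωu≤1) }

lemma1 : ∀ {c ℓ₁ ℓ₂} (ℝ : CompleteOrderedField c ℓ₁ ℓ₂) →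
         let open CompleteOrderedField ℝ
             open OWL ℝ
         in ∀ (n : ℕ) .{{_ : NonZero n}} (w : ℝ^ n) →
            MonotoneNonNegative w → ¬ IsZero w →
            ∀ (x : ℝ^ n) →
            IsDualNorm (Ω w) x (maximum (λ i → τ w i * ‖ x ₍ i ₎ ‖₁))
lemma1 ℝ n w w↓ w≉0 x = isDualNorm ℝ n w w↓ w≉0 x
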